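{- Every class of graphs can be decided by a $3$ adaptive hom algorithm.
   Context: Graphs are finite, simple, undirected, with non-empty vertex set; classes are closed under isomorphism; $\textsc{Graph}$ denotes the class of all graphs. $\hom(F,G)$ is the number of homomorphisms from $F$ to $G$. For $k\ge1$, a $k$ adaptive hom algorithm for a class $\mathcal C$ consists of a graph $F$ (starting graph), a function $N:\bigcup_{i\in[k-1]}\mathbb N^i\to\textsc{Graph}$ (next graph function), and a set $X\subseteq\mathbb N^k$ such that for all graphs $G$: $G\in\mathcal C\iff(n_1,\dots,n_k)\in X$, where $n_1:=\hom(F,G)$ and $n_{j+1}:=\hom(N(n_1,\dots,n_j),G)$ for $j\in[k-1]$. -}

module Defs where

open import Data.Nat using (ℕ; zero; suc; _+_)
open import Data.Fin using (Fin)
open import Data.Bool using (Bool; true; false; not; _∨_; if_then_else_)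
open import Data.List using (List; []; _∷_; map; concatMap; allFin; foldr)
open import Data.Bool using (_∧_)
open import Data.Vec using (Vec; lookup) renaming ([] to []ᵛ; _∷_ to _∷ᵛ_)
open import Data.Product using (Σ; _×_; _,_)
open import Function.Bundles using (_↔_; Inverse; _⇔_)
open import Relation.Binary.PropositionalEquality using (_≡_)

record Graph : Set where
  field
    n     : ℕ                       -- the graph has (suc n) ≥ 1 vertices
    adj   : Fin (suc n) → Fin (suc n) → Bool
    sym   : ∀ u v → adj u v ≡ adj v u
    irref : ∀ v → adj v v ≡ false

open Graph public

allB : {A : Set} → (A → Bool) → List A → Bool
allB p = foldr (λ x b → p x ∧ b) true

sumℕ : List ℕ → ℕ
sumℕ = foldr _+_ 0

V : Graph → Set
V G = Fin (suc (n G))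

-- All maps Fin m → Fin k, as vectors (an explicit enumeration without repetition).
allVecs : (m k : ℕ) → List (Vec (Fin k) m)
allVecs zero    k = []ᵛ ∷ []
allVecs (suc m) k = concatMap (λ x → map (x ∷ᵛ_) (allVecs m k)) (allFin k)

isHom : (F G : Graph) → Vec (V G) (suc (n F)) → Bool
isHom F G h =
  allB (λ u → allB (λ v → not (adj F u v) ∨ adj G (lookup h u) (lookup h v))
                 (allFin (suc (n F))))
      (allFin (suc (n F)))

hom : Graph → Graph → ℕ
hom F G = sumℕ (map (λ h → if isHom F G h then 1 else 0)
                   (allVecs (suc (n F)) (suc (n G))))

_≅_ : Graph → Graph → Set
G ≅ H = Σ (V G ↔ V H) λ f →
          ∀ u v → adj G u v ≡ adj H (Inverse.to f u) (Inverse.to f v)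

IsoClosed : (Graph → Set) → Set
IsoClosed C = ∀ G H → G ≅ H → C G → C H

-- A 3 adaptive hom algorithm: starting graph F, next graph function
-- N : ℕ¹ ∪ ℕ² → Graph (given as its two components N₁, N₂), and X ⊆ ℕ³.
record Adaptive3 : Set₁ where
  field
    start : Graph
    next₁ : ℕ → Graph
    next₂ : ℕ → ℕ → Graph
    accept : ℕ → ℕ → ℕ → Set

Decides3 : Adaptive3 → (Graph → Set) → Set
Decides3 A C = ∀ G →
  let n₁ = hom (Adaptive3.start A) G
      n₂ = hom (Adaptive3.next₁ A n₁) G
      n₃ = hom (Adaptive3.next₂ A n₁ n₂) G
  in C G ⇔ Adaptive3.accept A n₁ n₂ n₃

{-# OPTIONS --safe #-}

-- Let G have s vertices, a number read off from K₁. The second query is an odd cycle K, long enough to map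
-- to every non-bipartite graph on s vertices. The third query is a disjoint union of copies of K′ and of all
-- graphs F up to a certain order with F → K′, where K′ = K if G is not bipartite and K′ = K₂ otherwise.
-- All these counts are positive once hom K′ G is, so for suitable multiplicities every hom F G can be
-- recovered from the product.
--
-- Inclusion-exclusion over edges and over identified vertices turns these counts into the existence of exact
-- embeddings (Lovász). For bipartite G, a graph F that does not map to K₂ has hom F G = 0, so all counts are
-- known and an embedding is an isomorphism. Otherwise the admissible F are those coloured by K, and one obtains
-- injections φ c : V G → V H for c ∈ K with  u ~ v ⇔ φ c u ~ φ d v  whenever c ~ d in K. Then φ c u and φ e u
-- are twins if c and e have a common neighbour, hence for all c and e since K is an odd cycle, and every φ c is
-- an isomorphism.

module Submission where

open import Defs
open import Data.Product using (Σ)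

open import Algebra.Properties.Semiring.Sum as Sum using ()
open import Data.Bool using (Bool; true; false; not; _∧_; _∨_; if_then_else_) renaming (_≟_ to _≟ᵇ_)
open import Data.Bool.Properties using (∨-comm; ∨-idem; ∧-assoc; ∧-comm; ∧-identityʳ)
open import Data.Empty using (⊥-elim)
open import Data.Fin using (Fin; zero; suc; toℕ; fromℕ<; punchIn; punchOut; splitAt; _↑ˡ_; _↑ʳ_; combine; remQuot; cast)
open import Data.Fin.Properties using (_≟_; any?; punchIn-punchOut; punchOut-injective; remQuot-combine; injective⇒≤; toℕ-fromℕ<; toℕ<n; toℕ-injective; splitAt-↑ˡ; splitAt-↑ʳ; toℕ-cast)
open import Data.List using (List; []; _∷_; map; concatMap; allFin; tabulate; _++_; length; cartesianProduct; filter; upTo)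
open import Data.List.Membership.Propositional using (_∈_; find)
open import Data.List.Membership.Propositional.Properties using (∈-allFin; ∈-cartesianProduct⁺; ∈-filter⁺; ∈-map⁺; ∈-++⁺ˡ; ∈-++⁺ʳ; ∈-concatMap⁺; ∈-upTo⁺)
open import Data.List.Properties using (map-++; map-tabulate)
open import Data.List.Relation.Unary.All as All using (All; []; _∷_)
open import Data.List.Relation.Unary.All.Properties using (all-filter)
open import Data.List.Relation.Unary.Any as Any using (Any; here; there)
open import Data.Nat using (ℕ; zero; suc; _+_; _*_; _^_; _≤_; _<_; z≤n; s≤s; NonZero; >-nonZero; _∸_; parity)
open import Data.Nat.ListAction.Properties using (sum-++)
open import Data.Nat.Properties as ℕ using (+-*-semiring)
open import Data.Nat.Tactic.RingSolver using (solve-∀)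
open import Data.Parity.Base using (Parity; 0ℙ; 1ℙ) renaming (_+_ to _+ₚ_)
open import Data.Parity.Properties using (+-homo-+; p+p≡0ℙ) renaming (_≟_ to _≟ₚ_; +-cancelʳ-≡ to +ₚ-cancelʳ)
open import Data.Product using (_×_; _,_; proj₁; proj₂; ∃; uncurry)
open import Data.Sum as Sum⊎ using (_⊎_; inj₁; inj₂; [_,_]′)
open import Data.Vec as Vec using (Vec; lookup; insertAt) renaming ([] to []ᵛ; _∷_ to _∷ᵛ_; _++_ to _++ᵛ_)
open import Data.Vec.Properties using (lookup-splitAt; insertAt-lookup; insertAt-punchIn; lookup∘tabulate; lookup-++ˡ; lookup-++ʳ)
open import Function using (_∘_; id)
open import Function.Bundles using (mk⇔; mk↔ₛ′)
open import Relation.Binary.Definitions using (tri<; tri≈; tri>)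
open import Relation.Binary.PropositionalEquality using (_≡_; _≢_; refl; trans; cong; cong₂; subst; module ≡-Reasoning; subst₂) renaming (sym to ≡-sym)
open import Relation.Nullary using (¬_; Dec; yes; no; ⌊_⌋; _×-dec_; _⊎-dec_)

open Sum +-*-semiring using (sum; sum-cong-≗; ∑-distrib-+; ∑-comm; *-distribˡ-sum; *-distribʳ-sum; sum-replicate-zero)

private
  variable
    k : ℕ
    A : Set

-- Booleans and indicator values

bool-ext : ∀ {a b} → (a ≡ true → b ≡ true) → (b ≡ true → a ≡ true) → a ≡ b
bool-ext {true}          f g = ≡-sym (f refl)
bool-ext {false} {true}  f g = g refl
bool-ext {false} {false} f g = refl

∧-true : ∀ {a b} → a ≡ true → b ≡ true → a ∧ b ≡ true
∧-true refl refl = refl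

∧-trueˡ : ∀ {a b} → a ∧ b ≡ true → a ≡ true
∧-trueˡ {true} _ = refl

∧-trueʳ : ∀ {a b} → a ∧ b ≡ true → b ≡ true
∧-trueʳ {true} p = p

not-∨-true : ∀ {a b} → not a ∨ b ≡ true → a ≡ true → b ≡ true
not-∨-true {true} p _ = p

true-⌊⌋ : {P : Set} (P? : Dec P) → P → ⌊ P? ⌋ ≡ true
true-⌊⌋ (yes _)  _ = refl
true-⌊⌋ (no ¬p) p = ⊥-elim (¬p p)

⌊⌋-true : {P : Set} (P? : Dec P) → ⌊ P? ⌋ ≡ true → P
⌊⌋-true (yes p) _ = p

allB-true : (p : A → Bool) (xs : List A) → (∀ {x} → x ∈ xs → p x ≡ true) → allB p xs ≡ true
allB-true p []       f = refl
allB-true p (x ∷ xs) f = ∧-true (f (here refl)) (allB-true p xs (f ∘ there))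

allB-∈ : (p : A → Bool) (xs : List A) → allB p xs ≡ true → ∀ {x} → x ∈ xs → p x ≡ true
allB-∈ p (x ∷ xs) e (here refl) = ∧-trueˡ e
allB-∈ p (x ∷ xs) e (there i)   = allB-∈ p xs (∧-trueʳ {p x} e) i

𝟙 : Bool → ℕ
𝟙 b = if b then 1 else 0

𝟙-∧ : ∀ a b → 𝟙 (a ∧ b) ≡ 𝟙 a * 𝟙 b
𝟙-∧ true  b = ≡-sym (ℕ.+-identityʳ (𝟙 b))
𝟙-∧ false b = refl

𝟙≤1 : ∀ b → 𝟙 b ≤ 1
𝟙≤1 true  = s≤s z≤n
𝟙≤1 false = z≤n

𝟙-pos : ∀ {b} → 0 < 𝟙 b → b ≡ true
𝟙-pos {true} _ = refl

-- Sums over all vectors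

sumVec : ∀ m → (Vec (Fin k) m → ℕ) → ℕ
sumVec zero    f = f []ᵛ
sumVec (suc m) f = sum (λ x → sumVec m (λ h → f (x ∷ᵛ h)))

sumVec-cong : ∀ m {f g : Vec (Fin k) m → ℕ} → (∀ h → f h ≡ g h) → sumVec m f ≡ sumVec m g
sumVec-cong zero    e = e []ᵛ
sumVec-cong (suc m) e = sum-cong-≗ (λ x → sumVec-cong m (λ h → e (x ∷ᵛ h)))

sumVec-+ : ∀ m (f g : Vec (Fin k) m → ℕ) → sumVec m (λ h → f h + g h) ≡ sumVec m f + sumVec m g
sumVec-+ zero    f g = refl
sumVec-+ (suc m) f g = trans
  (sum-cong-≗ {x = λ x → sumVec m (λ h → f (x ∷ᵛ h) + g (x ∷ᵛ h))} (λ x → sumVec-+ m (f ∘ (x ∷ᵛ_)) (g ∘ (x ∷ᵛ_))))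
  (∑-distrib-+ (λ x → sumVec m (f ∘ (x ∷ᵛ_))) (λ x → sumVec m (g ∘ (x ∷ᵛ_))))

sumVec-*ˡ : ∀ m c (f : Vec (Fin k) m → ℕ) → sumVec m (λ h → c * f h) ≡ c * sumVec m f
sumVec-*ˡ zero    c f = refl
sumVec-*ˡ (suc m) c f = trans
  (sum-cong-≗ {x = λ x → sumVec m (λ h → c * f (x ∷ᵛ h))} (λ x → sumVec-*ˡ m c (f ∘ (x ∷ᵛ_))))
  (≡-sym (*-distribˡ-sum c (λ x → sumVec m (f ∘ (x ∷ᵛ_)))))

sumVec-*ʳ : ∀ m c (f : Vec (Fin k) m → ℕ) → sumVec m (λ h → f h * c) ≡ sumVec m f * c
sumVec-*ʳ zero    c f = refl
sumVec-*ʳ (suc m) c f = trans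
  (sum-cong-≗ {x = λ x → sumVec m (λ h → f (x ∷ᵛ h) * c)} (λ x → sumVec-*ʳ m c (f ∘ (x ∷ᵛ_))))
  (≡-sym (*-distribʳ-sum c (λ x → sumVec m (f ∘ (x ∷ᵛ_)))))

sumVec-sum : ∀ m {l} (f : Vec (Fin k) m → Fin l → ℕ) →
  sumVec m (λ h → sum (f h)) ≡ sum (λ x → sumVec m (λ h → f h x))
sumVec-sum zero    f = refl
sumVec-sum (suc m) f = trans
  (sum-cong-≗ {x = λ y → sumVec m (λ h → sum (f (y ∷ᵛ h)))} (λ y → sumVec-sum m (f ∘ (y ∷ᵛ_))))
  (∑-comm (λ y x → sumVec m (λ h → f (y ∷ᵛ h) x)))

sumVec-++ : ∀ m {l} (f : Vec (Fin k) (m + l) → ℕ) →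
  sumVec (m + l) f ≡ sumVec m (λ h → sumVec l (λ h′ → f (h ++ᵛ h′)))
sumVec-++ zero    f = refl
sumVec-++ (suc m) f = sum-cong-≗ {x = λ x → sumVec (m + _) (f ∘ (x ∷ᵛ_))} (λ x → sumVec-++ m (f ∘ (x ∷ᵛ_)))

-- Finite sums commute, so the sum over coordinate `i` can be moved innermost. This isolates a
-- coordinate that is determined by the others.
sumVec-insertAt : ∀ m (i : Fin (suc m)) (f : Vec (Fin k) (suc m) → ℕ) →
  sumVec (suc m) f ≡ sumVec m (λ h → sum (λ x → f (insertAt h i x)))
sumVec-insertAt m       zero    f = ≡-sym (sumVec-sum m (λ h x → f (x ∷ᵛ h)))
sumVec-insertAt (suc m) (suc i) f = sum-cong-≗ {x = λ y → sumVec (suc m) (f ∘ (y ∷ᵛ_))} (λ y → sumVec-insertAt m i (f ∘ (y ∷ᵛ_)))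

sum-zero : ∀ {l} (f : Fin l → ℕ) → (∀ x → f x ≡ 0) → sum f ≡ 0
sum-zero {l} f e = trans (sum-cong-≗ e) (sum-replicate-zero l)

sum-≟ : ∀ {l} (y : Fin l) (r : Fin l → Bool) → sum (λ x → 𝟙 (⌊ x ≟ y ⌋ ∧ r x)) ≡ 𝟙 (r y)
sum-≟ zero    r = trans (cong (𝟙 (r zero) +_) (sum-zero (λ x → 𝟙 (⌊ suc x ≟ zero ⌋ ∧ r (suc x))) (λ _ → refl))) (ℕ.+-identityʳ _)
sum-≟ (suc y) r = trans (sum-cong-≗ (λ x → cong (λ b → 𝟙 (b ∧ r (suc x))) (suc-≟ x))) (sum-≟ y (r ∘ suc))
  where
  suc-≟ : ∀ x → ⌊ suc x ≟ suc y ⌋ ≡ ⌊ x ≟ y ⌋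
  suc-≟ x with x ≟ y
  ... | yes _ = refl
  ... | no  _ = refl

sum-pos : ∀ {l} (f : Fin l → ℕ) x → 0 < f x → 0 < sum f
sum-pos f zero    p = ℕ.m≤n⇒m≤n+o _ p
sum-pos f (suc x) p = ℕ.m≤n⇒m≤o+n (f zero) (sum-pos (f ∘ suc) x p)

pos-sum : ∀ {l} (f : Fin l → ℕ) → 0 < sum f → ∃ λ x → 0 < f x
pos-sum {suc l} f p with f zero in eq
... | suc _ = zero , subst (0 <_) (≡-sym eq) (s≤s z≤n)
... | zero  with x , q ← pos-sum (f ∘ suc) p = suc x , q

sumVec-pos : ∀ m (f : Vec (Fin k) m → ℕ) h → 0 < f h → 0 < sumVec m f
sumVec-pos zero    f []ᵛ      p = p
sumVec-pos (suc m) f (x ∷ᵛ h) p = sum-pos _ x (sumVec-pos m _ h p)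

pos-sumVec : ∀ m (f : Vec (Fin k) m → ℕ) → 0 < sumVec m f → ∃ λ h → 0 < f h
pos-sumVec zero    f p = []ᵛ , p
pos-sumVec (suc m) f p with x , q ← pos-sum _ p with h , r ← pos-sumVec m _ q = (x ∷ᵛ h) , r

sum-≤ : ∀ {l} (f : Fin l → ℕ) c → (∀ x → f x ≤ c) → sum f ≤ l * c
sum-≤ {zero}  f c b = z≤n
sum-≤ {suc l} f c b = ℕ.+-mono-≤ (b zero) (sum-≤ (f ∘ suc) c (b ∘ suc))

sumVec-≤ : ∀ m (f : Vec (Fin k) m → ℕ) → (∀ h → f h ≤ 1) → sumVec m f ≤ k ^ m
sumVec-≤ zero    f b = b []ᵛ
sumVec-≤ (suc m) f b = sum-≤ _ _ (λ x → sumVec-≤ m _ (λ h → b (x ∷ᵛ h)))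

-- Agreement of the list enumeration with nested sums

sumℕ-map-concatMap : {B : Set} (f : B → ℕ) (g : A → List B) (xs : List A) →
  sumℕ (map f (concatMap g xs)) ≡ sumℕ (map (λ x → sumℕ (map f (g x))) xs)
sumℕ-map-concatMap f g []       = refl
sumℕ-map-concatMap f g (x ∷ xs) = begin
  sumℕ (map f (g x ++ concatMap g xs))                 ≡⟨ cong sumℕ (map-++ f (g x) _) ⟩
  sumℕ (map f (g x) ++ map f (concatMap g xs))         ≡⟨ sum-++ (map f (g x)) _ ⟩
  sumℕ (map f (g x)) + sumℕ (map f (concatMap g xs))   ≡⟨ cong (sumℕ (map f (g x)) +_) (sumℕ-map-concatMap f g xs) ⟩
  sumℕ (map f (g x)) + sumℕ (map (λ y → sumℕ (map f (g y))) xs) ∎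
  where open ≡-Reasoning

sumℕ-tabulate : ∀ {l} (f : Fin l → ℕ) → sumℕ (tabulate f) ≡ sum f
sumℕ-tabulate {zero}  f = refl
sumℕ-tabulate {suc l} f = cong (f zero +_) (sumℕ-tabulate (f ∘ suc))

sumℕ-map-map : {B : Set} (f : B → ℕ) (g : A → B) (xs : List A) →
  sumℕ (map f (map g xs)) ≡ sumℕ (map (f ∘ g) xs)
sumℕ-map-map f g []       = refl
sumℕ-map-map f g (x ∷ xs) = cong (f (g x) +_) (sumℕ-map-map f g xs)

sumℕ-allVecs : ∀ m k (f : Vec (Fin k) m → ℕ) → sumℕ (map f (allVecs m k)) ≡ sumVec m f
sumℕ-allVecs zero    k f = ℕ.+-identityʳ _
sumℕ-allVecs (suc m) k f = begin
  sumℕ (map f (allVecs (suc m) k))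
    ≡⟨ sumℕ-map-concatMap f _ (allFin k) ⟩
  sumℕ (map g (allFin k))
    ≡⟨ cong sumℕ (map-tabulate id g) ⟩
  sumℕ (tabulate g)
    ≡⟨ sumℕ-tabulate g ⟩
  sum g
    ≡⟨ sum-cong-≗ {x = g} (λ x → trans (sumℕ-map-map f (x ∷ᵛ_) (allVecs m k)) (sumℕ-allVecs m k (f ∘ (x ∷ᵛ_)))) ⟩
  sumVec (suc m) f ∎
  where
  open ≡-Reasoning
  g : Fin k → ℕ
  g x = sumℕ (map f (map (x ∷ᵛ_) (allVecs m k)))

∈-allVecs : ∀ m k (h : Vec (Fin k) m) → h ∈ allVecs m k
∈-allVecs zero    k []ᵛ      = here refl
∈-allVecs (suc m) k (x ∷ᵛ h) =
  ∈-concatMap⁺ (λ y → map (y ∷ᵛ_) (allVecs m k)) (Any.map (λ { refl → ∈-map⁺ (x ∷ᵛ_) (∈-allVecs m k h) }) (∈-allFin x))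

-- Homomorphism counts

∣_∣ᵥ : Graph → ℕ
∣ G ∣ᵥ = suc (n G)

IsHom : (F G : Graph) → (V F → V G) → Set
IsHom F G h = ∀ u v → adj F u v ≡ true → adj G (h u) (h v) ≡ true

preservesᵇ : ∀ F G → Vec (V G) ∣ F ∣ᵥ → V F → V F → Bool
preservesᵇ F G h u v = not (adj F u v) ∨ adj G (lookup h u) (lookup h v)

isHom⇒IsHom : ∀ F G h → isHom F G h ≡ true → IsHom F G (lookup h)
isHom⇒IsHom F G h e u v = not-∨-true
  (allB-∈ (preservesᵇ F G h u) (allFin ∣ F ∣ᵥ)
    (allB-∈ (λ u → allB (preservesᵇ F G h u) (allFin ∣ F ∣ᵥ)) (allFin ∣ F ∣ᵥ) e (∈-allFin u))
    (∈-allFin v))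

IsHom⇒isHom : ∀ F G h → IsHom F G (lookup h) → isHom F G h ≡ true
IsHom⇒isHom F G h p = allB-true _ (allFin ∣ F ∣ᵥ) (λ {u} _ → allB-true (preservesᵇ F G h u) (allFin ∣ F ∣ᵥ) (λ {v} _ → preserved u v))
  where
  preserved : ∀ u v → preservesᵇ F G h u v ≡ true
  preserved u v with adj F u v in eq
  ... | true  = p u v eq
  ... | false = refl

hom≡sumVec : ∀ F G → hom F G ≡ sumVec ∣ F ∣ᵥ (λ h → 𝟙 (isHom F G h))
hom≡sumVec F G = sumℕ-allVecs ∣ F ∣ᵥ ∣ G ∣ᵥ (λ h → 𝟙 (isHom F G h))

hom-pos : ∀ F G (h : V F → V G) → IsHom F G h → 0 < hom F G
hom-pos F G h p rewrite hom≡sumVec F G =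
  sumVec-pos ∣ F ∣ᵥ (λ h → 𝟙 (isHom F G h)) (Vec.tabulate h)
    (subst (λ b → 0 < 𝟙 b) (≡-sym (IsHom⇒isHom F G (Vec.tabulate h) q)) (s≤s z≤n))
  where
  q : IsHom F G (lookup (Vec.tabulate h))
  q u v a rewrite lookup∘tabulate h u | lookup∘tabulate h v = p u v a

pos-hom : ∀ F G → 0 < hom F G → ∃ (IsHom F G)
pos-hom F G p rewrite hom≡sumVec F G with h , q ← pos-sumVec ∣ F ∣ᵥ _ p =
  lookup h , isHom⇒IsHom F G h (𝟙-pos q)

hom-pos-trans : ∀ F K G → 0 < hom F K → 0 < hom K G → 0 < hom F G
hom-pos-trans F K G p q with f , f-hom ← pos-hom F K p with g , g-hom ← pos-hom K G q =
  hom-pos F G (g ∘ f) (λ u v a → g-hom _ _ (f-hom u v a))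

hom≤ : ∀ F G → hom F G ≤ ∣ G ∣ᵥ ^ ∣ F ∣ᵥ
hom≤ F G rewrite hom≡sumVec F G = sumVec-≤ ∣ F ∣ᵥ _ (λ h → 𝟙≤1 (isHom F G h))

-- The second graph is given by its components so that both have definitionally the same vertices.
hom-congˡ : ∀ F a s i G → (∀ u v → adj F u v ≡ a u v) →
  hom F G ≡ hom (record { n = n F ; adj = a ; sym = s ; irref = i }) G
hom-congˡ F a s i G e = begin
  hom F G                                  ≡⟨ hom≡sumVec F G ⟩
  sumVec ∣ F ∣ᵥ (λ h → 𝟙 (isHom F G h))    ≡⟨ sumVec-cong ∣ F ∣ᵥ (λ h → cong 𝟙 (bool-ext (to h) (from h))) ⟩
  sumVec ∣ F ∣ᵥ (λ h → 𝟙 (isHom F′ G h))   ≡⟨ hom≡sumVec F′ G ⟨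
  hom F′ G                                 ∎
  where
  open ≡-Reasoning
  F′ : Graph
  F′ = record { n = n F ; adj = a ; sym = s ; irref = i }
  to : ∀ h → isHom F G h ≡ true → isHom F′ G h ≡ true
  to h p = IsHom⇒isHom F′ G h (λ u v q → isHom⇒IsHom F G h p u v (trans (e u v) q))
  from : ∀ h → isHom F′ G h ≡ true → isHom F G h ≡ true
  from h p = IsHom⇒isHom F G h (λ u v q → isHom⇒IsHom F′ G h p u v (trans (≡-sym (e u v)) q))

-- Disjoint unions

_⊕_ : Graph → Graph → Graph
n (F ⊕ F′) = n F + ∣ F′ ∣ᵥ
adj (F ⊕ F′) u v with splitAt ∣ F ∣ᵥ u | splitAt ∣ F ∣ᵥ v
... | inj₁ a | inj₁ b = adj F a b
... | inj₂ a | inj₂ b = adj F′ a b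
... | inj₁ _ | inj₂ _ = false
... | inj₂ _ | inj₁ _ = false
sym (F ⊕ F′) u v with splitAt ∣ F ∣ᵥ u | splitAt ∣ F ∣ᵥ v
... | inj₁ a | inj₁ b = sym F a b
... | inj₂ a | inj₂ b = sym F′ a b
... | inj₁ _ | inj₂ _ = refl
... | inj₂ _ | inj₁ _ = refl
irref (F ⊕ F′) v with splitAt ∣ F ∣ᵥ v
... | inj₁ a = irref F a
... | inj₂ a = irref F′ a

isHom-⊕ : ∀ F F′ G h h′ → isHom (F ⊕ F′) G (h ++ᵛ h′) ≡ isHom F G h ∧ isHom F′ G h′
isHom-⊕ F F′ G h h′ = bool-ext to from
  where
  to : isHom (F ⊕ F′) G (h ++ᵛ h′) ≡ true → isHom F G h ∧ isHom F′ G h′ ≡ true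
  to e = ∧-true (IsHom⇒isHom F G h left) (IsHom⇒isHom F′ G h′ right)
    where
    p = isHom⇒IsHom (F ⊕ F′) G (h ++ᵛ h′) e
    left : IsHom F G (lookup h)
    left u v a = trans
      (≡-sym (cong₂ (adj G) (lookup-++ˡ h h′ u) (lookup-++ˡ h h′ v)))
      (p (u ↑ˡ ∣ F′ ∣ᵥ) (v ↑ˡ ∣ F′ ∣ᵥ) a′)
      where
      a′ : adj (F ⊕ F′) (u ↑ˡ ∣ F′ ∣ᵥ) (v ↑ˡ ∣ F′ ∣ᵥ) ≡ true
      a′ rewrite splitAt-↑ˡ ∣ F ∣ᵥ u ∣ F′ ∣ᵥ | splitAt-↑ˡ ∣ F ∣ᵥ v ∣ F′ ∣ᵥ = a
    right : IsHom F′ G (lookup h′)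
    right u v a = trans
      (≡-sym (cong₂ (adj G) (lookup-++ʳ h h′ u) (lookup-++ʳ h h′ v)))
      (p (∣ F ∣ᵥ ↑ʳ u) (∣ F ∣ᵥ ↑ʳ v) a′)
      where
      a′ : adj (F ⊕ F′) (∣ F ∣ᵥ ↑ʳ u) (∣ F ∣ᵥ ↑ʳ v) ≡ true
      a′ rewrite splitAt-↑ʳ ∣ F ∣ᵥ ∣ F′ ∣ᵥ u | splitAt-↑ʳ ∣ F ∣ᵥ ∣ F′ ∣ᵥ v = a
  from : isHom F G h ∧ isHom F′ G h′ ≡ true → isHom (F ⊕ F′) G (h ++ᵛ h′) ≡ true
  from e = IsHom⇒isHom (F ⊕ F′) G (h ++ᵛ h′) both
    where
    both : IsHom (F ⊕ F′) G (lookup (h ++ᵛ h′))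
    both u v a rewrite lookup-splitAt ∣ F ∣ᵥ h h′ u | lookup-splitAt ∣ F ∣ᵥ h h′ v
      with splitAt ∣ F ∣ᵥ u | splitAt ∣ F ∣ᵥ v
    ... | inj₁ x | inj₁ y = isHom⇒IsHom F G h (∧-trueˡ e) x y a
    ... | inj₂ x | inj₂ y = isHom⇒IsHom F′ G h′ (∧-trueʳ {isHom F G h} e) x y a
    both u v () | inj₁ _ | inj₂ _
    both u v () | inj₂ _ | inj₁ _

hom-⊕ : ∀ F F′ G → hom (F ⊕ F′) G ≡ hom F G * hom F′ G
hom-⊕ F F′ G = begin
  hom (F ⊕ F′) G
    ≡⟨ hom≡sumVec (F ⊕ F′) G ⟩
  sumVec (∣ F ∣ᵥ + ∣ F′ ∣ᵥ) (λ h → 𝟙 (isHom (F ⊕ F′) G h))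
    ≡⟨ sumVec-++ ∣ F ∣ᵥ (λ h → 𝟙 (isHom (F ⊕ F′) G h)) ⟩
  sumVec ∣ F ∣ᵥ (λ h → sumVec ∣ F′ ∣ᵥ (λ h′ → 𝟙 (isHom (F ⊕ F′) G (h ++ᵛ h′))))
    ≡⟨ sumVec-cong ∣ F ∣ᵥ (λ h → sumVec-cong ∣ F′ ∣ᵥ (λ h′ →
         trans (cong 𝟙 (isHom-⊕ F F′ G h h′)) (𝟙-∧ (isHom F G h) (isHom F′ G h′)))) ⟩
  sumVec ∣ F ∣ᵥ (λ h → sumVec ∣ F′ ∣ᵥ (λ h′ → 𝟙 (isHom F G h) * 𝟙 (isHom F′ G h′)))
    ≡⟨ sumVec-cong ∣ F ∣ᵥ (λ h → sumVec-*ˡ ∣ F′ ∣ᵥ (𝟙 (isHom F G h)) (λ h′ → 𝟙 (isHom F′ G h′))) ⟩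
  sumVec ∣ F ∣ᵥ (λ h → 𝟙 (isHom F G h) * sumVec ∣ F′ ∣ᵥ (λ h′ → 𝟙 (isHom F′ G h′)))
    ≡⟨ sumVec-*ʳ ∣ F ∣ᵥ (sumVec ∣ F′ ∣ᵥ (λ h′ → 𝟙 (isHom F′ G h′))) (λ h → 𝟙 (isHom F G h)) ⟩
  sumVec ∣ F ∣ᵥ (λ h → 𝟙 (isHom F G h)) * sumVec ∣ F′ ∣ᵥ (λ h′ → 𝟙 (isHom F′ G h′))
    ≡⟨ cong₂ _*_ (hom≡sumVec F G) (hom≡sumVec F′ G) ⟨
  hom F G * hom F′ G ∎
  where open ≡-Reasoning

-- Yields 1 + j copies, since graphs are non-empty.
copies : ℕ → Graph → Graph
copies zero    F = F
copies (suc j) F = F ⊕ copies j F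

hom-copies : ∀ j F G → hom (copies j F) G ≡ hom F G ^ suc j
hom-copies zero    F G = ≡-sym (ℕ.*-identityʳ _)
hom-copies (suc j) F G = trans (hom-⊕ F (copies j F) G) (cong (hom F G *_) (hom-copies j F G))

-- Decoding products of powers

-- Bernoulli's inequality (1 + 1/y)^(j+1) ≥ 1 + (j+1)/y, cleared of denominators.
bernoulli : ∀ y j → y ^ j * (y + suc j) ≤ suc y ^ suc j
bernoulli y zero    = ℕ.≤-reflexive (base y)
  where
  base : ∀ y → 1 * (y + 1) ≡ suc y * 1
  base = solve-∀
bernoulli y (suc j) = begin
  y * y ^ j * (y + suc (suc j))                       ≤⟨ ℕ.m≤m+n _ (y ^ j * suc j) ⟩
  y * y ^ j * (y + suc (suc j)) + y ^ j * suc j       ≡⟨ step y (y ^ j) j ⟩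
  suc y * (y ^ j * (y + suc j))                       ≤⟨ ℕ.*-monoʳ-≤ (suc y) (bernoulli y j) ⟩
  suc y * suc y ^ suc j                               ∎
  where
  open ℕ.≤-Reasoning
  step : ∀ y p j → y * p * (y + suc (suc j)) + p * suc j ≡ suc y * (p * (y + suc j))
  step = solve-∀

-- A larger base outweighs cofactors up to `d`: by `bernoulli`, passing from `y` to `suc y` gains
-- more than a factor `d`, because the exponent exceeds `y * d`.
power-gap : ∀ {x y a b d} j → 0 < y → y < x → 0 < a → b ≤ d → y * d ≤ j → y ^ suc j * b < x ^ suc j * a
power-gap {x} {y} {a} {b} {d} j 0<y y<x 0<a b≤d yd≤j = begin-strict
  y ^ suc j * b       ≤⟨ ℕ.*-monoʳ-≤ (y ^ suc j) b≤d ⟩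
  y * y ^ j * d       ≡⟨ rearrange y (y ^ j) d ⟩
  y ^ j * (y * d)     ≤⟨ ℕ.*-monoʳ-≤ (y ^ j) yd≤j ⟩
  y ^ j * j           <⟨ ℕ.*-monoʳ-< (y ^ j) (ℕ.≤-trans (ℕ.n<1+n j) (ℕ.m≤n+m (suc j) y)) ⟩
  y ^ j * (y + suc j) ≤⟨ bernoulli y j ⟩
  suc y ^ suc j       ≤⟨ ℕ.^-monoˡ-≤ (suc j) y<x ⟩
  x ^ suc j           ≡⟨ ℕ.*-identityʳ (x ^ suc j) ⟨
  x ^ suc j * 1       ≤⟨ ℕ.*-monoʳ-≤ (x ^ suc j) 0<a ⟩
  x ^ suc j * a       ∎
  where
  open ℕ.≤-Reasoning
  instance
    y≢0 : NonZero y
    y≢0 = >-nonZero 0<y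
    yʲ≢0 : NonZero (y ^ j)
    yʲ≢0 = ℕ.m^n≢0 y j
  rearrange : ∀ y p d → y * p * d ≡ p * (y * d)
  rearrange = solve-∀

-- The exponent exceeds both `x * d` and `y * d`, so `power-gap` excludes different bases; equal
-- powers then cancel.
decode : ∀ {x y a b c d} → 0 < x → 0 < y → x ≤ c → y ≤ c → 0 < a → 0 < b → a ≤ d → b ≤ d →
  x ^ suc (c * d) * a ≡ y ^ suc (c * d) * b → x ≡ y × a ≡ b
decode {x} {y} {a} {b} {c} {d} 0<x 0<y x≤c y≤c 0<a 0<b a≤d b≤d eq with ℕ.<-cmp x y
... | tri< x<y _ _ = ⊥-elim (ℕ.<-irrefl eq (power-gap (c * d) 0<x x<y 0<b a≤d (ℕ.*-monoˡ-≤ d x≤c)))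
... | tri> _ _ y<x = ⊥-elim (ℕ.<-irrefl (≡-sym eq) (power-gap (c * d) 0<y y<x 0<a b≤d (ℕ.*-monoˡ-≤ d y≤c)))
... | tri≈ _ refl _ = refl , ℕ.*-cancelˡ-≡ a b (x ^ suc (c * d)) {{ℕ.m^n≢0 x (suc (c * d)) {{>-nonZero 0<x}}}} eq

-- The multiplicities are chosen so that, on graphs with s vertices, `decode` applies.
bundle : ℕ → Graph → List Graph → Graph
bundle s K []       = K
bundle s K (F ∷ Fs) = copies (s ^ ∣ F ∣ᵥ * s ^ ∣ bundle s K Fs ∣ᵥ) F ⊕ bundle s K Fs

hom-bundle : ∀ s K F Fs G → hom (bundle s K (F ∷ Fs)) G ≡
  hom F G ^ suc (s ^ ∣ F ∣ᵥ * s ^ ∣ bundle s K Fs ∣ᵥ) * hom (bundle s K Fs) G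
hom-bundle s K F Fs G = trans (hom-⊕ (copies j F) (bundle s K Fs) G) (cong (_* hom (bundle s K Fs) G) (hom-copies j F G))
  where
  j = s ^ ∣ F ∣ᵥ * s ^ ∣ bundle s K Fs ∣ᵥ

*-pos : ∀ {a b} → 0 < a → 0 < b → 0 < a * b
*-pos {suc a} {suc b} _ _ = s≤s z≤n

*-posʳ : ∀ a {b} → 0 < a * b → 0 < b
*-posʳ a {suc b} _ = s≤s z≤n
*-posʳ a {zero}  p = ⊥-elim (ℕ.<-irrefl (≡-sym (ℕ.*-zeroʳ a)) p)

^-pos : ∀ {a} j → 0 < a → 0 < a ^ j
^-pos zero    p = s≤s z≤n
^-pos (suc j) p = *-pos p (^-pos j p)

bundle-pos : ∀ s K Fs G → All (λ F → 0 < hom F K) Fs → 0 < hom K G → 0 < hom (bundle s K Fs) G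
bundle-pos s K []       G []       p = p
bundle-pos s K (F ∷ Fs) G (q ∷ qs) p rewrite hom-bundle s K F Fs G =
  *-pos (^-pos (suc (s ^ ∣ F ∣ᵥ * s ^ ∣ bundle s K Fs ∣ᵥ)) (hom-pos-trans F K G q p)) (bundle-pos s K Fs G qs p)

-- `K` itself is the last summand of the bundle, so its count is a factor of the product.
pos-bundle : ∀ s K Fs G → 0 < hom (bundle s K Fs) G → 0 < hom K G
pos-bundle s K []       G p = p
pos-bundle s K (F ∷ Fs) G p rewrite hom-bundle s K F Fs G =
  pos-bundle s K Fs G (*-posʳ (hom F G ^ suc (s ^ ∣ F ∣ᵥ * s ^ ∣ bundle s K Fs ∣ᵥ)) p)

-- The factors are peeled off one by one with `decode`. They are positive because each `F` maps to
-- `K`, which maps to both graphs, and bounded by the number of all maps.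
bundle-separates : ∀ s K Fs G H → ∣ G ∣ᵥ ≡ s → ∣ H ∣ᵥ ≡ s → 0 < hom K G → 0 < hom K H →
  All (λ F → 0 < hom F K) Fs → hom (bundle s K Fs) G ≡ hom (bundle s K Fs) H →
  All (λ F → hom F G ≡ hom F H) Fs
bundle-separates s K []       G H eG eH pG pH []       e = []
bundle-separates s K (F ∷ Fs) G H eG eH pG pH (q ∷ qs) e =
  proj₁ d ∷ bundle-separates s K Fs G H eG eH pG pH qs (proj₂ d)
  where
  bound : ∀ F G → ∣ G ∣ᵥ ≡ s → hom F G ≤ s ^ ∣ F ∣ᵥ
  bound F G refl = hom≤ F G
  Q = bundle s K Fs
  d : hom F G ≡ hom F H × hom Q G ≡ hom Q H
  d = decode (hom-pos-trans F K G q pG) (hom-pos-trans F K H q pH) (bound F G eG) (bound F H eH)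
        (bundle-pos s K Fs G qs pG) (bundle-pos s K Fs H qs pH) (bound Q G eG) (bound Q H eH)
        (trans (≡-sym (hom-bundle s K F Fs G)) (trans e (hom-bundle s K F Fs H)))

-- Enumerating graphs

module _ (l : ℕ) (b : Vec (Fin 2) (suc l * suc l)) where

  bit : Fin (suc l) → Fin (suc l) → Bool
  bit u v = ⌊ lookup b (combine u v) ≟ suc zero ⌋

  graphOf : Graph
  n     graphOf = l
  -- Clearing the diagonal and symmetrising makes every bit vector a valid code.
  adj   graphOf u v = not ⌊ u ≟ v ⌋ ∧ (bit u v ∨ bit v u)
  sym   graphOf u v = cong₂ (λ a c → not a ∧ c) (≟-sym u v) (∨-comm (bit u v) (bit v u))
    where
    ≟-sym : ∀ u v → ⌊ u ≟ v ⌋ ≡ ⌊ v ≟ u ⌋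
    ≟-sym u v = bool-ext (λ e → true-⌊⌋ (v ≟ u) (≡-sym (⌊⌋-true (u ≟ v) e)))
                         (λ e → true-⌊⌋ (u ≟ v) (≡-sym (⌊⌋-true (v ≟ u) e)))
  irref graphOf v rewrite true-⌊⌋ (v ≟ v) refl = refl

graphs : ℕ → List Graph
graphs M = concatMap (λ l → map (graphOf l) (allVecs (suc l * suc l) 2)) (upTo M)

-- Decoding restores the adjacency of `F` pointwise, so the result is stated through counts into
-- every `G` instead of an equality of graphs.
graphs-complete : ∀ M F → n F < M → ∃ λ F′ → F′ ∈ graphs M × (∀ G → hom F′ G ≡ hom F G)
graphs-complete M F F<M = F′ , b∈ , λ G → ≡-sym (hom-congˡ F (adj F′) (sym F′) (irref F′) G same)
  where
  code : Bool → Fin 2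
  code a = if a then suc zero else zero
  cell : Fin (∣ F ∣ᵥ * ∣ F ∣ᵥ) → Fin 2
  cell i = code (uncurry (adj F) (remQuot ∣ F ∣ᵥ i))
  b : Vec (Fin 2) (∣ F ∣ᵥ * ∣ F ∣ᵥ)
  b = Vec.tabulate cell
  F′ : Graph
  F′ = graphOf (n F) b
  b∈ : F′ ∈ graphs M
  b∈ = ∈-concatMap⁺ (λ l → map (graphOf l) (allVecs (suc l * suc l) 2))
         (Any.map (λ { refl → ∈-map⁺ (graphOf (n F)) (∈-allVecs _ 2 b) }) (∈-upTo⁺ F<M))
  decode-code : ∀ a → ⌊ code a ≟ suc zero ⌋ ≡ a
  decode-code true  = refl
  decode-code false = refl
  bit≡adj : ∀ u v → bit (n F) b u v ≡ adj F u v
  bit≡adj u v = begin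
    ⌊ lookup b (combine u v) ≟ suc zero ⌋            ≡⟨ cong (λ x → ⌊ x ≟ suc zero ⌋) (lookup∘tabulate cell (combine u v)) ⟩
    ⌊ cell (combine u v) ≟ suc zero ⌋                ≡⟨ decode-code _ ⟩
    uncurry (adj F) (remQuot ∣ F ∣ᵥ (combine u v))   ≡⟨ cong (uncurry (adj F)) (remQuot-combine u v) ⟩
    adj F u v                                        ∎
    where open ≡-Reasoning
  same : ∀ u v → adj F u v ≡ adj F′ u v
  same u v with u ≟ v
  ... | yes refl = irref F u
  ... | no  _    rewrite bit≡adj u v | bit≡adj v u | sym F v u = ≡-sym (∨-idem (adj F u v))

mapsTo? : ∀ K F → Dec (0 < hom F K)
mapsTo? K F = 1 ℕ.≤? hom F K

-- Opaque, since conversion checking would otherwise enumerate graphs.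
opaque

  query : ℕ → ℕ → Graph → Graph
  query s M K = bundle s K (filter (mapsTo? K) (graphs M))

  query-separates : ∀ s M K G H → ∣ G ∣ᵥ ≡ s → ∣ H ∣ᵥ ≡ s → 0 < hom K G → 0 < hom K H →
    hom (query s M K) G ≡ hom (query s M K) H →
    ∀ F → n F < M → 0 < hom F K → hom F G ≡ hom F H
  query-separates s M K G H eG eH pG pH e F F<M F→K with F′ , F′∈ , same ← graphs-complete M F F<M =
    trans (≡-sym (same G)) (trans F′-equal (same H))
    where
    F′-equal : hom F′ G ≡ hom F′ H
    F′-equal = All.lookup
      (bundle-separates s K _ G H eG eH pG pH (all-filter (mapsTo? K) (graphs M)) e)
      (∈-filter⁺ (mapsTo? K) F′∈ (subst (0 <_) (≡-sym (same K)) F→K))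

  -- The query is positive exactly when `hom K` is. In the bipartite case this is how the third
  -- answer reveals whether there is an edge.
  pos-query : ∀ s M K G H → hom (query s M K) G ≡ hom (query s M K) H → 0 < hom K G → 0 < hom K H
  pos-query s M K G H e p = pos-bundle s K Fs H (subst (0 <_) e (bundle-pos s K Fs G (all-filter (mapsTo? K) (graphs M)) p))
    where
    Fs : List Graph
    Fs = filter (mapsTo? K) (graphs M)

-- Contracting equalities

merge : ∀ {N} {i j : Fin (suc N)} → i ≢ j → Fin (suc N) → Fin N
merge {i = i} i≢j w with i ≟ w
... | yes _   = punchOut i≢j
... | no  i≢w = punchOut i≢w

-- A colouring that agrees on `i` and `j` descends to the quotient, in which `i` is deleted in
-- favour of `j`.
merge-preserves : ∀ {N} {B : Set} {i j : Fin (suc N)} (i≢j : i ≢ j) (c : Fin (suc N) → B) →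
  c i ≡ c j → ∀ w → c (punchIn i (merge i≢j w)) ≡ c w
merge-preserves {i = i} i≢j c e w with i ≟ w
... | yes refl = trans (cong c (punchIn-punchOut i≢j)) (≡-sym e)
... | no  i≢w  = cong c (punchIn-punchOut i≢w)

lookup-merge : ∀ {N} {B : Set} {i j : Fin (suc N)} (i≢j : i ≢ j) (h : Vec B N) w →
  lookup (insertAt h i (lookup h (punchOut i≢j))) w ≡ lookup h (merge i≢j w)
lookup-merge {i = i} i≢j h w with i ≟ w
... | yes refl = insertAt-lookup h i _
... | no  i≢w  = trans (cong (lookup (insertAt h i _)) (≡-sym (punchIn-punchOut i≢w))) (insertAt-punchIn h i _ (punchOut i≢w))

-- Maps with equal values at `i` and `j` correspond to maps on the quotient: in the sum over
-- coordinate `i`, only one value contributes.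
sumVec-merge : ∀ {N l} {i j : Fin (suc N)} (i≢j : i ≢ j) (r : (Fin (suc N) → Fin l) → Bool) →
  (∀ {f g} → (∀ w → f w ≡ g w) → r f ≡ r g) →
  sumVec (suc N) (λ h → 𝟙 (⌊ lookup h i ≟ lookup h j ⌋ ∧ r (lookup h))) ≡
  sumVec N (λ h → 𝟙 (r (lookup h ∘ merge i≢j)))
sumVec-merge {N} {l} {i} {j} i≢j r r-cong = begin
  sumVec (suc N) f
    ≡⟨ sumVec-insertAt N i f ⟩
  sumVec N (λ h → sum (λ x → f (insertAt h i x)))
    ≡⟨ sumVec-cong N (λ h → sum-cong-≗ {x = λ x → f (insertAt h i x)} (λ x →
         cong (λ b → 𝟙 (b ∧ r (lookup (insertAt h i x)))) (cong₂ (λ y z → ⌊ y ≟ z ⌋) (insertAt-lookup h i x) (at-j h x)))) ⟩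
  sumVec N (λ h → sum (λ x → 𝟙 (⌊ x ≟ lookup h (punchOut i≢j) ⌋ ∧ r (lookup (insertAt h i x)))))
    ≡⟨ sumVec-cong N (λ h → sum-≟ (lookup h (punchOut i≢j)) (λ x → r (lookup (insertAt h i x)))) ⟩
  sumVec N (λ h → 𝟙 (r (lookup (insertAt h i (lookup h (punchOut i≢j))))))
    ≡⟨ sumVec-cong N (λ h → cong 𝟙 (r-cong (lookup-merge i≢j h))) ⟩
  sumVec N (λ h → 𝟙 (r (lookup h ∘ merge i≢j))) ∎
  where
  open ≡-Reasoning
  f : Vec (Fin l) (suc N) → ℕ
  f h = 𝟙 (⌊ lookup h i ≟ lookup h j ⌋ ∧ r (lookup h))
  at-j : ∀ h x → lookup (insertAt h i x) j ≡ lookup h (punchOut i≢j)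
  at-j h x = trans (cong (lookup (insertAt h i x)) (≡-sym (punchIn-punchOut i≢j))) (insertAt-punchIn h i x (punchOut i≢j))

-- Systems of edge and equality conditions

data Atom (M : ℕ) : Set where
  edge equal : Fin M → Fin M → Atom M

satisfies : ∀ {M} G → (Fin M → V G) → Atom M → Bool
satisfies G g (edge a b)  = adj G (g a) (g b)
satisfies G g (equal a b) = ⌊ g a ≟ g b ⌋

satisfies-cong : ∀ {M} G {f g : Fin M → V G} → (∀ a → f a ≡ g a) → ∀ x → satisfies G f x ≡ satisfies G g x
satisfies-cong G e (edge a b)  = cong₂ (adj G) (e a) (e b)
satisfies-cong G e (equal a b) = cong₂ (λ y z → ⌊ y ≟ z ⌋) (e a) (e b)

allB-cong : {B : Set} {p q : B → Bool} → (∀ x → p x ≡ q x) → ∀ xs → allB p xs ≡ allB q xs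
allB-cong e []       = refl
allB-cong e (x ∷ xs) = cong₂ _∧_ (e x) (allB-cong e xs)

∧-rotate : ∀ a b c → a ∧ (b ∧ c) ≡ (b ∧ a) ∧ c
∧-rotate a b c = trans (≡-sym (∧-assoc a b c)) (cong (_∧ c) (∧-comm a b))

-- The simple graph described by a list of edge conditions after identifying variables along `ρ`;
-- parallel edges collapse.
module Pattern {M N : ℕ} (ρ : Fin M → Fin (suc N)) (es : List (Fin M × Fin M))
  (loopless : ∀ {a b} → (a , b) ∈ es → ρ a ≢ ρ b) where

  Joins : Fin (suc N) → Fin (suc N) → Fin M × Fin M → Set
  Joins u v (a , b) = (ρ a ≡ u × ρ b ≡ v) ⊎ (ρ a ≡ v × ρ b ≡ u)

  joins? : ∀ u v e → Dec (Joins u v e)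
  joins? u v (a , b) = (ρ a ≟ u ×-dec ρ b ≟ v) ⊎-dec (ρ a ≟ v ×-dec ρ b ≟ u)

  joined? : ∀ u v → Dec (Any (Joins u v) es)
  joined? u v = Any.any? (joins? u v) es

  graph : Graph
  n     graph     = N
  adj   graph u v = ⌊ joined? u v ⌋
  sym   graph u v = bool-ext (λ p → true-⌊⌋ (joined? v u) (Any.map Sum⊎.swap (⌊⌋-true (joined? u v) p)))
                             (λ p → true-⌊⌋ (joined? u v) (Any.map Sum⊎.swap (⌊⌋-true (joined? v u) p)))
  irref graph v with joined? v v
  ... | no  _ = refl
  ... | yes p with find p
  ...   | _ , e∈ , inj₁ (refl , q) = ⊥-elim (loopless e∈ (≡-sym q))
  ...   | _ , e∈ , inj₂ (refl , q) = ⊥-elim (loopless e∈ (≡-sym q))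

  adj⇒edge : ∀ u v → adj graph u v ≡ true → ∃ λ e → e ∈ es × Joins u v e
  adj⇒edge u v p = find (⌊⌋-true (joined? u v) p)

  edge⇒adj : ∀ {a b} → (a , b) ∈ es → adj graph (ρ a) (ρ b) ≡ true
  edge⇒adj {a} {b} e∈ = true-⌊⌋ (joined? (ρ a) (ρ b)) (Any.map (λ { refl → inj₁ (refl , refl) }) e∈)

module _ {M : ℕ} where

  edgeSat : ∀ G → (Fin M → V G) → Fin M × Fin M → Bool
  edgeSat G g (a , b) = adj G (g a) (g b)

  -- `ρ` records the identifications made so far and `es` the edge conditions already absorbed,
  -- while `as` is still to be processed. Once `as` is empty, a homomorphism count or zero remains.
  count : ∀ G N → (Fin M → Fin N) → List (Fin M × Fin M) → List (Atom M) → ℕ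
  count G N ρ es as = sumVec N (λ h → 𝟙 (allB (edgeSat G (lookup h ∘ ρ)) es ∧ allB (satisfies G (lookup h ∘ ρ)) as))

  count-loop : ∀ G N (ρ : Fin M → Fin N) es as {a b} → (a , b) ∈ es → ρ a ≡ ρ b → count G N ρ es as ≡ 0
  count-loop G N ρ es as {a} {b} e∈ eq = ℕ.n<1⇒n≡0 (ℕ.≰⇒> impossible)
    where
    impossible : ¬ (0 < count G N ρ es as)
    impossible p with h , q ← pos-sumVec N _ p
      with trans (≡-sym (irref G (lookup h (ρ a)))) (trans (cong (adj G (lookup h (ρ a)) ∘ lookup h) eq)
             (allB-∈ (edgeSat G (lookup h ∘ ρ)) es (∧-trueˡ (𝟙-pos q)) e∈))
    ... | ()

  count-graph : ∀ G N (ρ : Fin M → Fin (suc N)) es (loopless : ∀ {a b} → (a , b) ∈ es → ρ a ≢ ρ b) →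
    count G (suc N) ρ es [] ≡ hom (Pattern.graph ρ es loopless) G
  count-graph G N ρ es loopless =
    trans (sumVec-cong (suc N) (λ h → cong 𝟙 (bool-ext (to h) (from h)))) (≡-sym (hom≡sumVec F G))
    where
    open Pattern ρ es loopless renaming (graph to F)
    to : ∀ h → allB (edgeSat G (lookup h ∘ ρ)) es ∧ true ≡ true → isHom F G h ≡ true
    to h p = IsHom⇒isHom F G h pres
      where
      pres : IsHom F G (lookup h)
      pres u v q with adj⇒edge u v q
      ... | _ , e∈ , inj₁ (refl , refl) = allB-∈ (edgeSat G (lookup h ∘ ρ)) es (∧-trueˡ p) e∈
      ... | _ , e∈ , inj₂ (refl , refl) = trans (sym G _ _) (allB-∈ (edgeSat G (lookup h ∘ ρ)) es (∧-trueˡ p) e∈)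
    from : ∀ h → isHom F G h ≡ true → allB (edgeSat G (lookup h ∘ ρ)) es ∧ true ≡ true
    from h p = ∧-true (allB-true _ es (λ {e} e∈ → isHom⇒IsHom F G h p _ _ (edge⇒adj e∈))) refl

  count-edge : ∀ G N (ρ : Fin M → Fin N) es a b as → count G N ρ es (edge a b ∷ as) ≡ count G N ρ ((a , b) ∷ es) as
  count-edge G N ρ es a b as = sumVec-cong N (λ h → cong 𝟙 
    (∧-rotate (allB (edgeSat G (lookup h ∘ ρ)) es) (satisfies G (lookup h ∘ ρ) (edge a b)) (allB (satisfies G (lookup h ∘ ρ)) as)))

  count-equal-same : ∀ G N (ρ : Fin M → Fin N) es a b as → ρ a ≡ ρ b →
    count G N ρ es (equal a b ∷ as) ≡ count G N ρ es as
  count-equal-same G N ρ es a b as e = sumVec-cong N (λ h → cong (λ c → 𝟙 (allB (edgeSat G (lookup h ∘ ρ)) es ∧ (c ∧ allB (satisfies G (lookup h ∘ ρ)) as)))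
    (true-⌊⌋ (lookup h (ρ a) ≟ lookup h (ρ b)) (cong (lookup h) e)))

  count-equal-merge : ∀ G N (ρ : Fin M → Fin (suc N)) es a b as (ρa≢ρb : ρ a ≢ ρ b) →
    count G (suc N) ρ es (equal a b ∷ as) ≡ count G N (merge ρa≢ρb ∘ ρ) es as
  count-equal-merge G N ρ es a b as ρa≢ρb = trans
    (sumVec-cong (suc N) (λ h → cong 𝟙 (reorder (lookup h))))
    (sumVec-merge ρa≢ρb (λ f → edges f ∧ rest f) (λ {f} {g} e → cong₂ _∧_
        (allB-cong (λ { (a , b) → cong₂ (adj G) (e (ρ a)) (e (ρ b)) }) es)
        (allB-cong (satisfies-cong G (e ∘ ρ)) as)))
    where
    edges rest : (Fin (suc N) → V G) → Bool
    edges f = allB (edgeSat G (f ∘ ρ)) es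
    rest f = allB (satisfies G (f ∘ ρ)) as
    reorder : ∀ f → edges f ∧ (⌊ f (ρ a) ≟ f (ρ b) ⌋ ∧ rest f) ≡ ⌊ f (ρ a) ≟ f (ρ b) ⌋ ∧ (edges f ∧ rest f)
    reorder f = trans (∧-rotate (edges f) ⌊ f (ρ a) ≟ f (ρ b) ⌋ (rest f)) (∧-assoc ⌊ f (ρ a) ≟ f (ρ b) ⌋ (edges f) (rest f))

literal : Bool → Bool → Bool
literal s b = if s then b else not b

literal-≡ : ∀ s b → literal s b ≡ true → s ≡ b
literal-≡ true  true  _ = refl
literal-≡ false false _ = refl

literal-refl : ∀ s → literal s s ≡ true
literal-refl true  = refl
literal-refl false = refl

-- Lovász's theorem relative to a colour relation K

module Coloured {M′ k : ℕ} (K : Fin k → Fin k → Bool) (K-sym : ∀ c d → K c d ≡ K d c)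
  (G H : Graph) (col : Fin (suc M′) → Fin k)
  (hom-equal : ∀ F → n F < suc M′ → (c : V F → Fin k) →
     (∀ u v → adj F u v ≡ true → K (c u) (c v) ≡ true) → hom F G ≡ hom F H)
  where

  M : ℕ
  M = suc M′

  -- Conditions whose processing keeps the pattern coloured: edges only between related colours,
  -- identifications only within a colour.
  Allowed : Atom M → Set
  Allowed (edge a b)  = K (col a) (col b) ≡ true
  Allowed (equal a b) = col a ≡ col b

  AllowedEdge : Fin M × Fin M → Set
  AllowedEdge (a , b) = Allowed (edge a b)

  -- Edge conditions become edges of the pattern and equalities contract it; `c` colours the current
  -- quotient. What is left is zero, because of a loop, or the count of a coloured graph on at most
  -- `M` vertices.
  count-agrees : ∀ N (ρ : Fin M → Fin (suc N)) (c : Fin (suc N) → Fin k) → N < M → (∀ a → c (ρ a) ≡ col a) →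
    ∀ es → All AllowedEdge es → ∀ as → All Allowed as → count G (suc N) ρ es as ≡ count H (suc N) ρ es as
  count-agrees N ρ c N<M c-col es oes [] [] with Any.any? (λ e → ρ (proj₁ e) ≟ ρ (proj₂ e)) es
  ... | yes loop with (a , b) , e∈ , q ← find loop =
    trans (count-loop G (suc N) ρ es [] e∈ q) (≡-sym (count-loop H (suc N) ρ es [] e∈ q))
  ... | no ¬loop = trans (count-graph G N ρ es loopless)
      (trans (hom-equal F N<M c coloured) (≡-sym (count-graph H N ρ es loopless)))
    where
    loopless : ∀ {a b} → (a , b) ∈ es → ρ a ≢ ρ b
    loopless e∈ q = ¬loop (Any.map (λ { refl → q }) e∈)
    open Pattern ρ es loopless renaming (graph to F)
    coloured : ∀ u v → adj F u v ≡ true → K (c u) (c v) ≡ true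
    coloured u v p with adj⇒edge u v p
    ... | (a , b) , e∈ , inj₁ (refl , refl) = trans (cong₂ K (c-col a) (c-col b)) (All.lookup oes e∈)
    ... | (a , b) , e∈ , inj₂ (refl , refl) = trans (K-sym _ _) (trans (cong₂ K (c-col a) (c-col b)) (All.lookup oes e∈))
  count-agrees N ρ c N<M c-col es oes (edge a b ∷ as) (o ∷ os) =
    trans (count-edge G (suc N) ρ es a b as)
      (trans (count-agrees N ρ c N<M c-col ((a , b) ∷ es) (o ∷ oes) as os) (≡-sym (count-edge H (suc N) ρ es a b as)))
  count-agrees N ρ c N<M c-col es oes (equal a b ∷ as) (o ∷ os) with ρ a ≟ ρ b
  ... | yes e = trans (count-equal-same G (suc N) ρ es a b as e)
      (trans (count-agrees N ρ c N<M c-col es oes as os) (≡-sym (count-equal-same H (suc N) ρ es a b as e)))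
  count-agrees zero ρ c N<M c-col es oes (equal a b ∷ as) (o ∷ os) | no ne with ρ a | ρ b
  ... | zero | zero = ⊥-elim (ne refl)
  count-agrees (suc N) ρ c N<M c-col es oes (equal a b ∷ as) (o ∷ os) | no ne =
    trans (count-equal-merge G (suc N) ρ es a b as ne)
      (trans (count-agrees N (merge ne ∘ ρ) (c ∘ punchIn (ρ a)) (ℕ.<-trans (ℕ.n<1+n N) N<M)
                (λ x → trans (merge-preserves ne c (trans (c-col a) (trans o (≡-sym (c-col b)))) (ρ x)) (c-col x))
                es oes as os)
        (≡-sym (count-equal-merge H (suc N) ρ es a b as ne)))

  module _ (sign : Atom M → Bool) where

    signed : ∀ X → (Fin M → V X) → List (Atom M) → Bool
    signed X g = allB (λ x → literal (sign x) (satisfies X g x))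

    mixed : ∀ X → List (Atom M) → List (Atom M) → ℕ
    mixed X ps as = sumVec M (λ h → 𝟙 (allB (satisfies X (lookup h)) ps ∧ signed X (lookup h) as))

    mixed-pos : ∀ X x ps as → sign x ≡ true → mixed X ps (x ∷ as) ≡ mixed X (x ∷ ps) as
    mixed-pos X x ps as e = sumVec-cong M (λ h → cong 𝟙 (trans
      (cong (λ s → allB (satisfies X (lookup h)) ps ∧ (literal s (satisfies X (lookup h) x) ∧ signed X (lookup h) as)) e)
      (∧-rotate (allB (satisfies X (lookup h)) ps) (satisfies X (lookup h) x) (signed X (lookup h) as))))

    -- The inclusion-exclusion step: solutions of the rest split by the truth of `x`. The additive
    -- form avoids subtraction of natural numbers.
    mixed-neg : ∀ X x ps as → sign x ≡ false → mixed X ps (x ∷ as) + mixed X (x ∷ ps) as ≡ mixed X ps as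
    mixed-neg X x ps as e = trans
        (≡-sym (sumVec-+ M
          (λ h → 𝟙 (allB (satisfies X (lookup h)) ps ∧ signed X (lookup h) (x ∷ as)))
          (λ h → 𝟙 (allB (satisfies X (lookup h)) (x ∷ ps) ∧ signed X (lookup h) as))))
        (sumVec-cong M (λ h → trans
          (cong (λ s → 𝟙 (allB (satisfies X (lookup h)) ps ∧ (literal s (satisfies X (lookup h) x) ∧ signed X (lookup h) as))
                     + 𝟙 (allB (satisfies X (lookup h)) (x ∷ ps) ∧ signed X (lookup h) as)) e)
          (split (allB (satisfies X (lookup h)) ps) (satisfies X (lookup h) x) (signed X (lookup h) as))))
      where
      split : ∀ p s q → 𝟙 (p ∧ (not s ∧ q)) + 𝟙 ((s ∧ p) ∧ q) ≡ 𝟙 (p ∧ q)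
      split true  true  q = refl
      split true  false q = ℕ.+-identityʳ _
      split false true  q = refl
      split false false q = refl

    -- Negative conditions are removed one at a time; cancelling the equal counts where `x` holds
    -- leaves those where it fails.
    mixed-agrees : ∀ ps as → All Allowed ps → All Allowed as → mixed G ps as ≡ mixed H ps as
    mixed-agrees ps [] ops [] = trans (mixed≡count G) (trans
        (count-agrees M′ id col ℕ.≤-refl (λ _ → refl) [] [] ps ops) (≡-sym (mixed≡count H)))
      where
      mixed≡count : ∀ X → mixed X ps [] ≡ count X M id [] ps
      mixed≡count X = sumVec-cong M (λ h → cong 𝟙 (∧-identityʳ (allB (satisfies X (lookup h)) ps)))
    mixed-agrees ps (x ∷ as) ops (o ∷ os) = by-sign (sign x) refl
      where
      open ≡-Reasoning
      by-sign : ∀ s → sign x ≡ s → mixed G ps (x ∷ as) ≡ mixed H ps (x ∷ as)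
      by-sign true  e = trans (mixed-pos G x ps as e) (trans (mixed-agrees (x ∷ ps) as (o ∷ ops) os) (≡-sym (mixed-pos H x ps as e)))
      by-sign false e = ℕ.+-cancelʳ-≡ (mixed G (x ∷ ps) as) _ _ (begin
        mixed G ps (x ∷ as) + mixed G (x ∷ ps) as  ≡⟨ mixed-neg G x ps as e ⟩
        mixed G ps as                              ≡⟨ mixed-agrees ps as ops os ⟩
        mixed H ps as                              ≡⟨ mixed-neg H x ps as e ⟨
        mixed H ps (x ∷ as) + mixed H (x ∷ ps) as  ≡⟨ cong (mixed H ps (x ∷ as) +_) (mixed-agrees (x ∷ ps) as (o ∷ ops) os) ⟨
        mixed H ps (x ∷ as) + mixed G (x ∷ ps) as  ∎)

  Allowed? : ∀ x → Dec (Allowed x)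
  Allowed? (edge a b)  = K (col a) (col b) ≟ᵇ true
  Allowed? (equal a b) = col a ≟ col b

  pairs : List (Fin M × Fin M)
  pairs = cartesianProduct (allFin M) (allFin M)

  atoms : List (Atom M)
  atoms = filter Allowed? (map (uncurry edge) pairs ++ map (uncurry equal) pairs)

  atoms-allowed : All Allowed atoms
  atoms-allowed = all-filter Allowed? (map (uncurry edge) pairs ++ map (uncurry equal) pairs)

  ∈-pairs : ∀ a b → (a , b) ∈ pairs
  ∈-pairs a b = ∈-cartesianProduct⁺ (∈-allFin a) (∈-allFin b)

  ∈-atoms : ∀ x → Allowed x → x ∈ atoms
  ∈-atoms (edge a b)  = ∈-filter⁺ Allowed? (∈-++⁺ˡ (∈-map⁺ (uncurry edge) (∈-pairs a b)))
  ∈-atoms (equal a b) = ∈-filter⁺ Allowed? (∈-++⁺ʳ (map (uncurry edge) pairs) (∈-map⁺ (uncurry equal) (∈-pairs a b)))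

  -- With `sign` given by the truth values of `g`, the map `g` itself is counted in `G`. The equal
  -- count in `H` is therefore positive, and any map counted there serves as `f`.
  transfer : (g : Fin M → V G) → ∃ λ (f : Fin M → V H) → ∀ x → Allowed x → satisfies G g x ≡ satisfies H f x
  transfer g = lookup (proj₁ witness) , λ x o →
      literal-≡ (sign x) _ (allB-∈ (lit H (proj₁ witness)) atoms (𝟙-pos (proj₂ witness)) (∈-atoms x o))
    where
    sign : Atom M → Bool
    sign = satisfies G g
    lit : ∀ X → Vec (V X) M → Atom M → Bool
    lit X h x = literal (sign x) (satisfies X (lookup h) x)
    g-signed : allB (lit G (Vec.tabulate g)) atoms ≡ true
    g-signed = allB-true (lit G (Vec.tabulate g)) atoms (λ {x} _ →
      trans (cong (literal (sign x)) (satisfies-cong G (lookup∘tabulate g) x)) (literal-refl (sign x)))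
    positive : 0 < mixed sign G [] atoms
    positive = sumVec-pos M (λ h → 𝟙 (allB (lit G h) atoms)) (Vec.tabulate g)
      (subst (λ b → 0 < 𝟙 b) (≡-sym g-signed) (s≤s z≤n))
    witness : ∃ λ h → 0 < 𝟙 (allB (lit H h) atoms)
    witness = pos-sumVec M (λ h → 𝟙 (allB (lit H h) atoms))
      (subst (0 <_) (mixed-agrees sign [] atoms [] atoms-allowed) positive)

-- `transfer` is applied to the projection of colour-vertex pairs onto vertices, so that one map
-- into `H` holds all `φ c`. Equalities within a colour yield injectivity, edges between related
-- colours the adjacencies.
lovász : ∀ {k′} (K : Fin (suc k′) → Fin (suc k′) → Bool) → (∀ c d → K c d ≡ K d c) → ∀ G H →
  (∀ F → n F < suc k′ * ∣ G ∣ᵥ → (c : V F → Fin (suc k′)) →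
     (∀ u v → adj F u v ≡ true → K (c u) (c v) ≡ true) → hom F G ≡ hom F H) →
  ∃ λ (φ : Fin (suc k′) → V G → V H) →
    (∀ c {u v} → φ c u ≡ φ c v → u ≡ v) ×
    (∀ c d → K c d ≡ true → ∀ u v → adj G u v ≡ adj H (φ c u) (φ d v))
lovász {k′} K K-sym G H hom-equal = φ , injective , preserves
  where
  split : Fin (suc k′ * ∣ G ∣ᵥ) → Fin (suc k′) × V G
  split = remQuot ∣ G ∣ᵥ
  colour : ∀ c (u : V G) → proj₁ (split (combine c u)) ≡ c
  colour c u = cong proj₁ (remQuot-combine c u)
  vertex : ∀ (c : Fin (suc k′)) u → proj₂ (split (combine c u)) ≡ u
  vertex c u = cong proj₂ (remQuot-combine c u)
  open Coloured K K-sym G H (proj₁ ∘ split) hom-equal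
  f = proj₁ (transfer (proj₂ ∘ split))
  agree = proj₂ (transfer (proj₂ ∘ split))
  φ : Fin (suc k′) → V G → V H
  φ c u = f (combine c u)
  injective : ∀ c {u v} → φ c u ≡ φ c v → u ≡ v
  injective c {u} {v} e = trans (≡-sym (vertex c u)) (trans same (vertex c v))
    where
    same : proj₂ (split (combine c u)) ≡ proj₂ (split (combine c v))
    same = ⌊⌋-true (_ ≟ _) (trans
      (agree (equal (combine c u) (combine c v)) (trans (colour c u) (≡-sym (colour c v))))
      (true-⌊⌋ (_ ≟ _) e))
  preserves : ∀ c d → K c d ≡ true → ∀ u v → adj G u v ≡ adj H (φ c u) (φ d v)
  preserves c d e u v = trans (cong₂ (adj G) (≡-sym (vertex c u)) (≡-sym (vertex d v)))
    (agree (edge (combine c u) (combine d v)) (trans (cong₂ K (colour c u) (colour d v)) e))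

-- From injections to isomorphisms

injective⇒surjective : ∀ {a b} → a ≡ b → (f : Fin a → Fin b) → (∀ {x y} → f x ≡ f y → x ≡ y) → ∀ y → ∃ λ x → f x ≡ y
injective⇒surjective {suc a} refl f f-inj y with any? (λ x → f x ≟ y)
... | yes p = p
-- Pigeonhole: a missed value `y` can be punched out, giving an injection into a smaller set.
... | no ¬p = ⊥-elim (ℕ.1+n≰n (injective⇒≤ {f = λ x → punchOut (avoid x)} (λ e → f-inj (punchOut-injective (avoid _) (avoid _) e))))
  where
  avoid : ∀ x → y ≢ f x
  avoid x e = ¬p (x , ≡-sym e)

injection⇒≅ : ∀ G H → ∣ G ∣ᵥ ≡ ∣ H ∣ᵥ → (f : V G → V H) → (∀ {u v} → f u ≡ f v → u ≡ v) →
  (∀ u v → adj G u v ≡ adj H (f u) (f v)) → G ≅ H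
injection⇒≅ G H e f f-inj f-adj = mk↔ₛ′ f (proj₁ ∘ f-surj) (proj₂ ∘ f-surj) (λ u → f-inj (proj₂ (f-surj (f u)))) , f-adj
  where
  f-surj : ∀ y → ∃ λ x → f x ≡ y
  f-surj = injective⇒surjective e f f-inj

-- Odd cycles

-- `p` is the last vertex; the second case closes the path into a cycle.
Arc : ℕ → ℕ → ℕ → Set
Arc p u v = suc u ≡ v ⊎ (u ≡ p × v ≡ 0)

Adjacent : ℕ → ℕ → ℕ → Set
Adjacent p u v = Arc p u v ⊎ Arc p v u

adjacent? : ∀ p u v → Dec (Adjacent p u v)
adjacent? p u v = arc? u v ⊎-dec arc? v u
  where
  arc? : ∀ u v → Dec (Arc p u v)
  arc? u v = suc u ℕ.≟ v ⊎-dec (u ℕ.≟ p ×-dec v ℕ.≟ 0)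

-- It has 2w + 3 vertices.
oddCycle : ℕ → Graph
n     (oddCycle w)     = suc w * 2
adj   (oddCycle w) u v = ⌊ adjacent? (suc w * 2) (toℕ u) (toℕ v) ⌋
sym   (oddCycle w) u v = bool-ext
  (λ e → true-⌊⌋ (adjacent? (suc w * 2) (toℕ v) (toℕ u)) (Sum⊎.swap (⌊⌋-true (adjacent? (suc w * 2) (toℕ u) (toℕ v)) e)))
  (λ e → true-⌊⌋ (adjacent? (suc w * 2) (toℕ u) (toℕ v)) (Sum⊎.swap (⌊⌋-true (adjacent? (suc w * 2) (toℕ v) (toℕ u)) e)))
irref (oddCycle w) v with adjacent? (suc w * 2) (toℕ v) (toℕ v)
... | no  _ = refl
... | yes p = ⊥-elim (noLoop p)
  where
  noArc : ∀ {x} → ¬ Arc (suc w * 2) x x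
  noArc (inj₁ e)        = ℕ.1+n≢n e
  noArc (inj₂ (refl , ()))
  noLoop : ∀ {x} → ¬ Adjacent (suc w * 2) x x
  noLoop = [ noArc , noArc ]′

-- Consecutive colours i, i + 1, i + 2 make φ i u and φ (i + 2) u twins, and going around an odd cycle
-- in steps of two passes from 0 to a neighbour of 0.
oddCycle-cancel : ∀ w G H → ∣ G ∣ᵥ ≡ ∣ H ∣ᵥ → (φ : V (oddCycle w) → V G → V H) →
  (∀ c {u v} → φ c u ≡ φ c v → u ≡ v) →
  (∀ c d → adj (oddCycle w) c d ≡ true → ∀ u v → adj G u v ≡ adj H (φ c u) (φ d v)) → G ≅ H
oddCycle-cancel w G H e φ φ-inj φ-adj = injection⇒≅ G H e (ψ 0 (s≤s z≤n)) (φ-inj _) (λ u v →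
    -- Colours `p` and 0 are adjacent, and `p` is even, so steps of two lead from 0 to `p`.
    trans (ψ-adj p 0 ℕ.≤-refl (s≤s z≤n) (inj₁ (inj₂ (refl , refl))) u v)
          (≡-sym (twins (suc w) ℕ.≤-refl u (ψ 0 (s≤s z≤n) v))))
  where
  p : ℕ
  p = suc w * 2
  -- The bound is irrelevant, so different proofs of it give the same map.
  ψ : ∀ i → .(i < suc p) → V G → V H
  ψ i i≤p = φ (fromℕ< i≤p)
  ψ-adj : ∀ i j (i≤p : i < suc p) (j≤p : j < suc p) → Adjacent p i j → ∀ u v → adj G u v ≡ adj H (ψ i i≤p u) (ψ j j≤p v)
  ψ-adj i j i≤p j≤p a = φ-adj (fromℕ< i≤p) (fromℕ< j≤p)
    (true-⌊⌋ (adjacent? p _ _) (subst₂ (Adjacent p) (≡-sym (toℕ-fromℕ< i≤p)) (≡-sym (toℕ-fromℕ< j≤p)) a))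
  twins : ∀ j (j≤p : j * 2 < suc p) u x → adj H (ψ 0 (s≤s z≤n) u) x ≡ adj H (ψ (j * 2) j≤p u) x
  twins zero    _   u x = refl
  twins (suc j) j≤p u x = trans (twins j j₀≤p u x) (step x)
    where
    j₁≤p : suc (j * 2) < suc p
    j₁≤p = ℕ.<-trans (ℕ.n<1+n _) j≤p
    j₀≤p : j * 2 < suc p
    j₀≤p = ℕ.<-trans (ℕ.n<1+n _) j₁≤p
    step : ∀ x → adj H (ψ (j * 2) j₀≤p u) x ≡ adj H (ψ (suc j * 2) j≤p u) x
    -- The map of the middle colour is onto, so `x` is the image of some `v` and both sides equal
    -- `adj G u v`.
    step x with v , refl ← injective⇒surjective e (ψ (suc (j * 2)) j₁≤p) (φ-inj _) x =
      trans (≡-sym (ψ-adj (j * 2) (suc (j * 2)) j₀≤p j₁≤p (inj₁ (inj₁ refl)) u v))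
            (ψ-adj (suc j * 2) (suc (j * 2)) j≤p j₁≤p (inj₂ (inj₁ refl)) u v)

-- Walks

data Walk (G : Graph) : V G → V G → ℕ → Set where
  nil  : ∀ {v} → Walk G v v 0
  cons : ∀ {u v x l} → adj G u v ≡ true → Walk G v x l → Walk G u x (suc l)

module _ {G : Graph} where

  append : ∀ {u v x l m} → Walk G u v l → Walk G v x m → Walk G u x (l + m)
  append nil        w′ = w′
  append (cons e w) w′ = cons e (append w w′)

  reverse-onto : ∀ {u v x l m} → Walk G u v l → Walk G u x m → Walk G v x (l + m)
  reverse-onto nil w′ = w′
  reverse-onto {l = suc l} {m} (cons e w) w′ =
    subst (Walk G _ _) (ℕ.+-suc l m) (reverse-onto w (cons (trans (sym G _ _) e) w′))

  at : ∀ {u v l} → Walk G u v l → ℕ → V G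
  at {u} w          zero    = u
  -- Default beyond the end: the walk rests at its last vertex.
  at {u} nil        (suc i) = u
  at     (cons _ w) (suc i) = at w i

  at-end : ∀ {u v l} (w : Walk G u v l) → at w l ≡ v
  at-end nil        = refl
  at-end (cons _ w) = at-end w

  at-adj : ∀ {u v l} (w : Walk G u v l) i → i < l → adj G (at w i) (at w (suc i)) ≡ true
  at-adj (cons e nil)        zero    _         = e
  at-adj (cons e (cons _ _)) zero    _         = e
  at-adj (cons _ w)          (suc i) (s≤s i<l) = at-adj w i i<l

  -- Going back and forth along the first edge adds two steps each time; the length is positive so
  -- that such an edge exists.
  pad : ∀ {u l} t → Walk G u u (suc l) → Walk G u u (t * 2 + suc l)
  pad zero    w            = w
  pad (suc t) w@(cons e _) = cons e (cons (trans (sym G _ _) e) (pad t w))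

  -- The cycle has as many vertices as the walk has steps, so vertex `i` goes to position `i`; the
  -- arc back to 0 goes to the final step.
  closedWalk⇒hom : ∀ w {x} → Walk G x x (suc (suc w * 2)) → 0 < hom (oddCycle w) G
  closedWalk⇒hom w {x} W = hom-pos (oddCycle w) G (at W ∘ toℕ) pres
    where
    p : ℕ
    p = suc w * 2
    arc-adj : ∀ i j → i < suc p → Arc p i j → adj G (at W i) (at W j) ≡ true
    arc-adj i j i<  (inj₁ refl)          = at-adj W i i<
    arc-adj i j i<  (inj₂ (refl , refl)) = subst (λ y → adj G (at W p) y ≡ true) (at-end W) (at-adj W p i<)
    pres : IsHom (oddCycle w) G (at W ∘ toℕ)
    pres u v e with ⌊⌋-true (adjacent? p (toℕ u) (toℕ v)) e
    ... | inj₁ a = arc-adj (toℕ u) (toℕ v) (toℕ<n u) a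
    ... | inj₂ a = trans (sym G _ _) (arc-adj (toℕ v) (toℕ u) (toℕ<n v) a)

-- Two-colourings and odd closed walks

K₂ : Graph
n     K₂     = 1
adj   K₂ u v = not ⌊ u ≟ v ⌋
sym   K₂ zero       zero       = refl
sym   K₂ zero       (suc zero) = refl
sym   K₂ (suc zero) zero       = refl
sym   K₂ (suc zero) (suc zero) = refl
irref K₂ zero       = refl
irref K₂ (suc zero) = refl

-- Joining two trees creates walks made of three old ones and the new edge, hence the recursion from
-- r to 3r + 1.
radius : ℕ → ℕ
radius zero    = 0
radius (suc j) = radius j + (radius j + suc (radius j))

parity-even : ∀ j → parity j ≡ 0ℙ → ∃ λ q → j ≡ q * 2
parity-even zero          _ = 0 , refl
parity-even (suc (suc j)) e with q , refl ← parity-even j e = suc q , refl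

parity-suc : ∀ j → parity (suc j) ≢ parity j
parity-suc (suc (suc j)) e = parity-suc j e

module _ (G : Graph) where

  -- Every vertex has a walk to the root of its component in the graph formed by the edges among es;
  -- its length parity is the colour.
  record Forest (es : List (V G × V G)) (r : ℕ) : Set where
    field
      root   : V G → V G
      len    : V G → ℕ
      walk   : ∀ v → Walk G v (root v) (len v)
      short  : ∀ v → len v ≤ r
      proper : ∀ {a b} → (a , b) ∈ es → adj G a b ≡ true → root a ≡ root b × parity (len a) ≢ parity (len b)

  OddClosedWalk : ℕ → Set
  OddClosedWalk r = ∃ λ x → ∃ λ q → q ≤ r × Walk G x x (suc (q * 2))

  radius-mono : ∀ r → r ≤ r + (r + suc r)
  radius-mono r = ℕ.m≤m+n r _

  -- Union-find with parities. An edge inside a tree either respects the colouring or closes an odd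
  -- walk through the root; an edge between two trees lets the tree of `u` be rerooted at the root
  -- of `v`.
  extend : ∀ {es r} u v → Forest es r → Forest ((u , v) ∷ es) (r + (r + suc r)) ⊎ OddClosedWalk (r + (r + suc r))
  extend {es} {r} u v T with adj G u v in uv | Forest.root T u ≟ Forest.root T v
  ... | false | _ = inj₁ (record
    { root = root ; len = len ; walk = walk ; short = λ x → ℕ.≤-trans (short x) (radius-mono r)
    ; proper = λ { (here refl) e → ⊥-elim (false≢true (trans (≡-sym uv) e)) ; (there i) → proper i } })
    where
    open Forest T
    false≢true : false ≢ true
    false≢true ()
  ... | true | yes ru≡rv with parity (Forest.len T u) ≟ₚ parity (Forest.len T v)
  ...   | no ne = inj₁ (record
    { root = root ; len = len ; walk = walk ; short = λ x → ℕ.≤-trans (short x) (radius-mono r)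
    ; proper = λ { (here refl) _ → ru≡rv , ne ; (there i) → proper i } })
    where open Forest T
  ...   | yes same = inj₂ (v , q , q≤ , subst (Walk G v v ∘ suc) even-len (cons vu closing))
    where
    open Forest T
    vu : adj G v u ≡ true
    vu = trans (sym G v u) uv
    -- The summand 0 comes from reversing onto the empty walk; the edge `vu` supplies the odd step.
    closing : Walk G u v (len u + (len v + 0))
    closing = append (walk u) (reverse-onto (subst (λ x → Walk G v x (len v)) (≡-sym ru≡rv) (walk v)) nil)
    total-even : parity (len u + (len v + 0)) ≡ 0ℙ
    total-even = begin
      parity (len u + (len v + 0))           ≡⟨ cong (λ j → parity (len u + j)) (ℕ.+-identityʳ (len v)) ⟩
      parity (len u + len v)                 ≡⟨ +-homo-+ (len u) (len v) ⟩
      parity (len u) +ₚ parity (len v)       ≡⟨ cong (_+ₚ parity (len v)) same ⟩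
      parity (len v) +ₚ parity (len v)       ≡⟨ p+p≡0ℙ (parity (len v)) ⟩
      0ℙ                                     ∎
      where open ≡-Reasoning
    q : ℕ
    q = proj₁ (parity-even (len u + (len v + 0)) total-even)
    even-len : len u + (len v + 0) ≡ q * 2
    even-len = proj₂ (parity-even (len u + (len v + 0)) total-even)
    q≤ : q ≤ r + (r + suc r)
    q≤ = begin
      q                       ≤⟨ ℕ.m≤m*n q 2 ⟩
      q * 2                   ≡⟨ even-len ⟨
      len u + (len v + 0)     ≤⟨ ℕ.+-mono-≤ (short u) (ℕ.+-mono-≤ (short v) z≤n) ⟩
      r + (r + suc r)         ∎
      where open ℕ.≤-Reasoning
  extend {es} {r} u v T | true | no ru≢rv = inj₁ (record
    { root = root′ ; len = len′ ; walk = walk′ ; short = short′ ; proper = proper′ })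
    where
    open Forest T
    -- Length of the way from the old root back to `u`, across the new edge and on to the root of
    -- `v`.
    detour : ℕ
    detour = len u + suc (len v)
    root′ : V G → V G
    root′ x with root x ≟ root u
    ... | yes _ = root v
    ... | no  _ = root x
    len′ : V G → ℕ
    len′ x with root x ≟ root u
    ... | yes _ = len x + detour
    ... | no  _ = len x
    walk′ : ∀ x → Walk G x (root′ x) (len′ x)
    walk′ x with root x ≟ root u
    ... | yes e = append (walk x) (subst (λ y → Walk G y (root v) detour) (≡-sym e) (reverse-onto (walk u) (cons uv (walk v))))
    ... | no  _ = walk x
    short′ : ∀ x → len′ x ≤ r + (r + suc r)
    short′ x with root x ≟ root u
    ... | yes _ = ℕ.+-mono-≤ (short x) (ℕ.+-mono-≤ (short u) (s≤s (short v)))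
    ... | no  _ = ℕ.≤-trans (short x) (radius-mono r)
    proper′ : ∀ {a b} → (a , b) ∈ ((u , v) ∷ es) → adj G a b ≡ true → root′ a ≡ root′ b × parity (len′ a) ≢ parity (len′ b)
    proper′ (here refl) _ with root u ≟ root u | root v ≟ root u
    ... | no ne | _     = ⊥-elim (ne refl)
    ... | yes _ | yes e = ⊥-elim (ru≢rv (≡-sym e))
    -- The new walk from `u` runs to the old root and back, which cancels modulo two and leaves
    -- `suc (len v)`.
    ... | yes _ | no _  = refl , λ e → parity-suc (len v) (trans (≡-sym collapse) e)
      where
      open ≡-Reasoning
      collapse : parity (len u + detour) ≡ parity (suc (len v))
      collapse = begin
        parity (len u + detour)                                     ≡⟨ cong parity (≡-sym (ℕ.+-assoc (len u) (len u) _)) ⟩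
        parity (len u + len u + suc (len v))                        ≡⟨ +-homo-+ (len u + len u) (suc (len v)) ⟩
        parity (len u + len u) +ₚ parity (suc (len v))              ≡⟨ cong (_+ₚ parity (suc (len v))) (trans (+-homo-+ (len u) (len u)) (p+p≡0ℙ (parity (len u)))) ⟩
        parity (suc (len v))                                        ∎
    proper′ {a} {b} (there i) ab with proper i ab | root a ≟ root u | root b ≟ root u
    ... | ra≡rb , ne | yes _  | yes _  = refl , λ e → ne (+ₚ-cancelʳ (parity detour) (parity (len a)) (parity (len b))
                                           (trans (≡-sym (+-homo-+ (len a) detour)) (trans e (+-homo-+ (len b) detour))))
    ... | ra≡rb , ne | no _   | no _   = ra≡rb , ne
    ... | ra≡rb , ne | yes ea | no nb  = ⊥-elim (nb (trans (≡-sym ra≡rb) ea))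
    ... | ra≡rb , ne | no na  | yes eb = ⊥-elim (na (trans ra≡rb eb))

  forest : ∀ es → Forest es (radius (length es)) ⊎ OddClosedWalk (radius (length es))
  forest [] = inj₁ (record { root = id ; len = λ _ → 0 ; walk = λ _ → nil ; short = λ _ → z≤n ; proper = λ () })
  forest ((u , v) ∷ es) with forest es
  ... | inj₁ T                = extend u v T
  ... | inj₂ (x , q , q≤ , W) = inj₂ (x , q , ℕ.≤-trans q≤ (radius-mono _) , W)

opaque

  -- Depends on the number of vertices alone, so the second query can be fixed from the first
  -- answer.
  oddWalkBound : ℕ → ℕ
  oddWalkBound s = radius (length (cartesianProduct (allFin s) (allFin s)))

  bipartite-or-oddCycle : ∀ G → 0 < hom G K₂ ⊎ 0 < hom (oddCycle (oddWalkBound ∣ G ∣ᵥ)) G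
  bipartite-or-oddCycle G with forest G (cartesianProduct (allFin ∣ G ∣ᵥ) (allFin ∣ G ∣ᵥ))
  ... | inj₁ T = inj₁ (hom-pos G K₂ (colour ∘ parity ∘ len) (λ u v uv →
      colour-adj (proj₂ (proper (∈-cartesianProduct⁺ (∈-allFin u) (∈-allFin v)) uv))))
    where
    open Forest T
    colour : Parity → Fin 2
    colour 0ℙ = zero
    colour 1ℙ = suc zero
    colour-adj : ∀ {a b} → a ≢ b → adj K₂ (colour a) (colour b) ≡ true
    colour-adj {0ℙ} {0ℙ} ne = ⊥-elim (ne refl)
    colour-adj {0ℙ} {1ℙ} ne = refl
    colour-adj {1ℙ} {0ℙ} ne = refl
    colour-adj {1ℙ} {1ℙ} ne = ⊥-elim (ne refl)
  -- The cycle has 2r + 3 vertices, so the walk of length 2q + 1 is padded by r + 1 - q detours of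
  -- two steps.
  ... | inj₂ (x , q , q≤ , W) = inj₂ (closedWalk⇒hom r (subst (Walk G x x) total (pad (suc r ∸ q) W)))
    where
    r : ℕ
    r = oddWalkBound ∣ G ∣ᵥ
    total : (suc r ∸ q) * 2 + suc (q * 2) ≡ suc (suc r * 2)
    total = begin
      (suc r ∸ q) * 2 + suc (q * 2)   ≡⟨ ℕ.+-suc _ (q * 2) ⟩
      suc ((suc r ∸ q) * 2 + q * 2)   ≡⟨ cong suc (≡-sym (ℕ.*-distribʳ-+ 2 (suc r ∸ q) q)) ⟩
      suc ((suc r ∸ q + q) * 2)       ≡⟨ cong (λ j → suc (j * 2)) (ℕ.m∸n+n≡m (ℕ.m≤n⇒m≤1+n q≤)) ⟩
      suc (suc r * 2)                 ∎
      where open ≡-Reasoning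

-- The queries and what they determine

K₁ : Graph
n     K₁     = 0
adj   K₁ _ _ = false
sym   K₁ _ _ = refl
irref K₁ _   = refl

hom-K₁ : ∀ G → hom K₁ G ≡ ∣ G ∣ᵥ
hom-K₁ G = trans (hom≡sumVec K₁ G) (sum-ones ∣ G ∣ᵥ)
  where
  sum-ones : ∀ l → sum {l} (λ _ → 1) ≡ l
  sum-ones zero    = refl
  sum-ones (suc l) = cong suc (sum-ones l)

second : ℕ → Graph
second s = oddCycle (oddWalkBound s)

-- On graphs with `s` vertices, the second answer 0 means bipartite. The order bounds are the
-- numbers of colour-vertex pairs in `lovász`, with a single colour in the bipartite case.
third : ℕ → ℕ → Graph
third s zero    = query s (1 * s) K₂
third s (suc _) = query s (∣ second s ∣ᵥ * s) (second s)

-- The colourings in `lovász` are homomorphisms to the odd cycle, so the query supplies every count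
-- that is required.
nonBipartite-determined : ∀ s G H → ∣ G ∣ᵥ ≡ s → ∣ H ∣ᵥ ≡ s → 0 < hom (second s) G → 0 < hom (second s) H →
  hom (query s (∣ second s ∣ᵥ * s) (second s)) G ≡ hom (query s (∣ second s ∣ᵥ * s) (second s)) H → G ≅ H
nonBipartite-determined s G H refl eH pG pH e =
  oddCycle-cancel (oddWalkBound s) G H (≡-sym eH) (proj₁ L) (proj₁ (proj₂ L)) (proj₂ (proj₂ L))
  where
  K = second s
  L = lovász (adj K) (sym K) G H (λ F F<M c c-hom →
        query-separates s (∣ K ∣ᵥ * s) K G H refl eH pG pH e F F<M (hom-pos F K c c-hom))

edgeless : ∀ G → ¬ (0 < hom K₂ G) → ∀ u v → adj G u v ≡ false
edgeless G np u v with adj G u v in uv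
... | false = refl
... | true  = ⊥-elim (np (hom-pos K₂ G ends pres))
  where
  ends : Fin 2 → V G
  ends zero       = u
  ends (suc zero) = v
  pres : IsHom K₂ G ends
  pres zero       (suc zero) _ = uv
  pres (suc zero) zero       _ = trans (sym G v u) uv
  pres zero       zero       ()
  pres (suc zero) (suc zero) ()

-- With one colour related to itself every `F` is admissible. Those not mapping to `K₂` have count 0
-- in both graphs; the query supplies the others if there is an edge. Otherwise both graphs are
-- edgeless and have the same order.
bipartite-determined : ∀ s G H → ∣ G ∣ᵥ ≡ s → ∣ H ∣ᵥ ≡ s → 0 < hom G K₂ → 0 < hom H K₂ →
  hom (query s (1 * s) K₂) G ≡ hom (query s (1 * s) K₂) H → G ≅ H
bipartite-determined s G H refl eH G→K₂ H→K₂ e = by-edges (mapsTo? G K₂)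
  where
  vanishes : ∀ F X → 0 < hom X K₂ → ¬ (0 < hom F K₂) → hom F X ≡ 0
  vanishes F X X→K₂ ¬F→K₂ = ℕ.n<1⇒n≡0 (ℕ.≰⇒> (λ F→X → ¬F→K₂ (hom-pos-trans F X K₂ F→X X→K₂)))
  hom-equal : 0 < hom K₂ G → 0 < hom K₂ H → ∀ F → n F < 1 * s → Dec (0 < hom F K₂) → hom F G ≡ hom F H
  hom-equal pG pH F F<M (yes F→K₂) = query-separates s (1 * s) K₂ G H refl eH pG pH e F F<M F→K₂
  hom-equal pG pH F F<M (no ¬F→K₂) = trans (vanishes F G G→K₂ ¬F→K₂) (≡-sym (vanishes F H H→K₂ ¬F→K₂))
  by-edges : Dec (0 < hom K₂ G) → G ≅ H
  by-edges (yes pG) = injection⇒≅ G H (≡-sym eH) (proj₁ L zero) (proj₁ (proj₂ L) zero) (proj₂ (proj₂ L) zero zero refl)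
    where
    L = lovász {0} (λ _ _ → true) (λ _ _ → refl) G H (λ F F<M _ _ →
          hom-equal pG (pos-query s (1 * s) K₂ G H e pG) F F<M (mapsTo? K₂ F))
  by-edges (no ¬pG) = injection⇒≅ G H (≡-sym eH) (cast (≡-sym eH))
    (λ {u} {v} q → toℕ-injective (trans (≡-sym (toℕ-cast (≡-sym eH) u)) (trans (cong toℕ q) (toℕ-cast (≡-sym eH) v))))
    (λ u v → trans (edgeless G ¬pG u v) (≡-sym (edgeless H (¬pG ∘ pos-query s (1 * s) K₂ H G (≡-sym e)) _ _)))

determined : ∀ s G H → ∣ G ∣ᵥ ≡ s → ∣ H ∣ᵥ ≡ s → ∀ m → hom (second s) G ≡ m → hom (second s) H ≡ m →
  hom (third s m) G ≡ hom (third s m) H → G ≅ H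
determined s G H eG eH (suc m) e₁ e₂ e = nonBipartite-determined s G H eG eH
  (subst (0 <_) (≡-sym e₁) (s≤s z≤n)) (subst (0 <_) (≡-sym e₂) (s≤s z≤n)) e
determined s G H eG eH zero e₁ e₂ e = bipartite-determined s G H eG eH (bipartite G eG e₁) (bipartite H eH e₂) e
  where
  bipartite : ∀ X → ∣ X ∣ᵥ ≡ s → hom (second s) X ≡ 0 → 0 < hom X K₂
  bipartite X refl z with bipartite-or-oddCycle X
  ... | inj₁ p = p
  ... | inj₂ p = ⊥-elim (ℕ.<-irrefl (≡-sym z) p)

-- A triple is accepted if some member of `C` realises it. As the triple determines the graph up to
-- isomorphism, every other graph realising it is in `C` too.
counts-decide : ∀ F N₁ N₂ →
  (∀ G H → let a = hom F H; b = hom (N₁ a) H in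
     hom F G ≡ a → hom (N₁ a) G ≡ b → hom (N₂ a b) G ≡ hom (N₂ a b) H → G ≅ H) →
  ∀ C → IsoClosed C → Σ Adaptive3 λ A → Decides3 A C
counts-decide F N₁ N₂ determines C C-iso = algorithm , λ G →
    mk⇔ (λ c → G , c , refl , refl , refl)
        (λ { (H , c , e₁ , e₂ , e₃) → C-iso H G (determines H G e₁ e₂ e₃) c })
  where
  algorithm : Adaptive3
  algorithm = record
    { start  = F
    ; next₁  = N₁
    ; next₂  = N₂
    ; accept = λ a b c → ∃ λ H → C H × hom F H ≡ a × hom (N₁ a) H ≡ b × hom (N₂ a b) H ≡ c
    }

theorem8p2 : (C : Graph → Set) → IsoClosed C → Σ Adaptive3 λ A → Decides3 A C
theorem8p2 = counts-decide K₁ second third (λ G H e₁ e₂ e₃ →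
  determined (hom K₁ H) G H (trans (≡-sym (hom-K₁ G)) e₁) (≡-sym (hom-K₁ H)) (hom (second (hom K₁ H)) H) e₂ refl e₃)
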